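{- Let $k\ge 1$ be an odd integer and let $N>0$ be an integer. There is no integer $C$ such that for every integer $n\ge 0$ there exists an integer index $j\ge 0$ (depending on $n$ and $N$) with $$\sum_{i=0}^{2N} P_k^{k-1}(n+i) = C\cdot P_k^{k-1}(j).$$
   Context: For an integer $k\ge 1$, the generalized Pell $(k,k-1)$-numbers $P_k^{k-1}(n)$, $n\ge 0$, are defined by $P_k^{k-1}(0)=P_k^{k-1}(1)=\cdots=P_k^{k-1}(k-1)=0$, $P_k^{k-1}(k)=1$, and $P_k^{k-1}(n)=2P_k^{k-1}(n-1)+P_k^{k-1}(n-k-1)$ for $n\ge k+1$. -}

module Defs where

open import Data.Empty using (⊥-elim)
open import Data.List.Base using (map; upTo)
open import Data.Nat.Base using (ℕ; zero; suc; _+_; _*_; _∸_; _<_)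
open import Data.Nat.ListAction using (sum)
open import Data.Nat.Properties using (<-cmp)
open import Relation.Binary.Definitions using (tri<; tri≈; tri>)
open import Relation.Binary.PropositionalEquality using (_≡_; refl; cong)

-- pell k n is P_k^{k-1}(n).  The auxiliary lag k n d is pell k (n ∸ d)
-- (see lag≡pell), computed by peeling off d successors so that the call
-- to the term k + 1 places back is accepted as structural recursion.
mutual
  pell : ℕ → ℕ → ℕ
  pell k n with <-cmp n k
  pell k n       | tri< _ _ _ = 0
  pell k n       | tri≈ _ _ _ = 1
  pell k (suc n) | tri> _ _ _ = 2 * pell k n + lag k n k

  lag : ℕ → ℕ → ℕ → ℕ
  lag k n       zero    = pell k n
  lag k zero    (suc d) = pell k zero
  lag k (suc n) (suc d) = lag k n d

lag≡pell : ∀ k n d → lag k n d ≡ pell k (n ∸ d)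
lag≡pell k n       zero    = refl
lag≡pell k zero    (suc d) = refl
lag≡pell k (suc n) (suc d) = lag≡pell k n d

pell-< : ∀ {k n} → n < k → pell k n ≡ 0
pell-< {k} {n} n<k with <-cmp n k
... | tri< _ _ _   = refl
... | tri≈ n≮k _ _ = ⊥-elim (n≮k n<k)
pell-< {k} {suc n} n<k | tri> n≮k _ _ = ⊥-elim (n≮k n<k)

pell-≡ : ∀ k → pell k k ≡ 1
pell-≡ k with <-cmp k k
... | tri< _ k≢k _ = ⊥-elim (k≢k refl)
... | tri≈ _ _ _   = refl
pell-≡ (suc k) | tri> _ k≢k _ = ⊥-elim (k≢k refl)

pell-> : ∀ {k n} → k < n → pell k n ≡ 2 * pell k (n ∸ 1) + pell k (n ∸ suc k)
pell-> {k} {n} k<n with <-cmp n k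
... | tri< _ _ n≯k = ⊥-elim (n≯k k<n)
... | tri≈ _ _ n≯k = ⊥-elim (n≯k k<n)
pell-> {k} {suc n} k<n | tri> _ _ _ = cong (2 * pell k n +_) (lag≡pell k n k)

pellSum : ℕ → ℕ → ℕ → ℕ
pellSum k N n = sum (map (λ i → pell k (n + i)) (upTo (suc (2 * N))))

{-# OPTIONS --safe #-}
-- Let S(n) be the sum of the m = 2N + 1 consecutive terms from P(n) on, and suppose
-- S(n) = C P(j(n)).  Since 2S(n) ≤ S(n+1) ≤ 3S(n) and 2P(n) ≤ P(n+1), j increases by exactly 1
-- from n = k on.  Differencing, x^A (x^m - 1) = C x^B (x - 1) for the shift operator x on P,
-- with x^(k+1) = 1 + 2 x^k.  Modulo 2, x has order k+1, which forces {A, A+m} ≡ {B, B+1}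
-- modulo k+1; for k ≥ 3, with u = x^(k+1), the relation becomes x u^p - u^q = ±C u^s (x - 1)
-- with p ≠ q.  Expanding u^(2^e b) ≡ 1 + 2^(e+1) b w modulo 2^(e+2) shows by induction on e
-- that p ≡ q ≡ s modulo 2^e for all e, hence p = q, a contradiction.  For k = 1, where this
-- argument fails, the norm form of ℤ[√2] is used instead.
module Submission where

open import Defs
open import Data.Empty using (⊥)
open import Data.Integer.Base using (ℤ; +_; -[1+_]; _*_; _+_; _-_; -_; _^_; ∣_∣; NonZero)
open import Data.Integer.Divisibility.Signed using (_∣_; divides; ∣⇒∣ᵤ; ∣m⇒∣-m; ∣m⇒∣m*n; ∣n⇒∣m*n; ∣m∣n⇒∣m+n; ∣m∣n⇒∣m-n)
open import Data.Integer.Properties using (*-cancelˡ-≡; +-injective; pos-*; pos-+; i*j≢0; abs-*; ^-*-assoc; ^-zeroˡ)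
open import Data.Integer.Tactic.RingSolver using (solve)
open import Data.List.Base using ([]; _∷_; applyUpTo)
open import Data.List.Properties using (map-upTo)
open import Data.Nat.Base as ℕ using (ℕ; zero; suc; _≤_; _<_; z≤n; s≤s; parity)
import Data.Nat.Divisibility as ℕ
open import Data.Nat.DivMod using (_/_; _%_; m≡m%n+[m/n]*n; m%n<n)
open import Data.Nat.Induction using (<-wellFounded; Acc; acc)
open import Data.Nat.ListAction using (sum)
import Data.Nat.Properties as ℕ
open import Data.Parity.Base using (1ℙ)
open import Data.Parity.Properties using (*-homo-*)
open import Data.Product.Base using (Σ-syntax; ∃-syntax; _×_; _,_; proj₁; proj₂)
open import Data.Sum.Base using (_⊎_; inj₁; inj₂; [_,_]′)
open import Function.Base using (case_of_)
open import Relation.Binary.Definitions using (tri<; tri≈; tri>)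
open import Relation.Binary.PropositionalEquality using (_≡_; _≢_; refl; sym; trans; cong; cong₂; subst; subst₂; module ≡-Reasoning)
open import Relation.Nullary.Decidable.Core using (yes; no)
open import Relation.Nullary.Negation.Core using (¬_; contradiction)

-- Shifting recurrent sequences by (k+1) 2^e

record Recurrent (k : ℕ) (F : ℕ → ℤ) : Set where
  constructor recurrent
  field recurrence : ∀ n → F (suc k ℕ.+ n) ≡ + 2 * F (k ℕ.+ n) + F n

open Recurrent

-- Writing x for the shift operator, which satisfies x^(k+1) = 1 + 2 x^k on
-- recurrent sequences, shiftQuotient k e is (x^((k+1) 2^e) - 1) / 2^(e+1).
shiftQuotient : ℕ → ℕ → (ℕ → ℤ) → ℕ → ℤ
shiftQuotient k zero    F n = F (k ℕ.+ n)
shiftQuotient k (suc e) F n =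
  shiftQuotient k e F n + (+ 2) ^ e * shiftQuotient k e (shiftQuotient k e F) n

period : ℕ → ℕ → ℕ
period k e = 2 ℕ.^ e ℕ.* suc k

period-suc : ∀ k e n → period k (suc e) ℕ.+ n ≡ period k e ℕ.+ (period k e ℕ.+ n)
period-suc k e n = trans
  (cong (ℕ._+ n) (trans (ℕ.*-assoc 2 (2 ℕ.^ e) (suc k)) (cong (period k e ℕ.+_) (ℕ.+-identityʳ _))))
  (ℕ.+-assoc (period k e) (period k e) n)

module _ {k : ℕ} where

  shiftQuotient-recurrent : ∀ e {F} → Recurrent k F → Recurrent k (shiftQuotient k e F)
  shiftQuotient-recurrent zero    {F} rec = recurrent λ n →
    trans (cong F (ℕ.+-suc k (k ℕ.+ n))) (recurrence rec (k ℕ.+ n))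
  shiftQuotient-recurrent (suc e) {F} rec = recurrent λ n →
    trans (cong₂ (λ a b → a + t * b) (recurrence recV n) (recurrence recVV n))
          (lemma (V F (k ℕ.+ n)) (V F n) (V (V F) (k ℕ.+ n)) (V (V F) n) t)
    where
    V    = shiftQuotient k e
    t    = (+ 2) ^ e
    recV = shiftQuotient-recurrent e rec
    recVV = shiftQuotient-recurrent e recV
    lemma : ∀ a b c d t → + 2 * a + b + t * (+ 2 * c + d) ≡ + 2 * (a + t * c) + (b + t * d)
    lemma a b c d t = solve (a ∷ b ∷ c ∷ d ∷ t ∷ [])

  -- By squaring: with V = `shiftQuotient k e` and t = 2^e, (1 + 2tV)^2 = 1 + 4t (V + t V^2), and
  -- the bracket is the recursion that defines the next quotient.
  shift-period : ∀ e {F} → Recurrent k F → ∀ n →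
    F (period k e ℕ.+ n) ≡ F n + (+ 2) ^ suc e * shiftQuotient k e F n
  shift-period zero    {F} rec n = trans (cong (λ i → F (suc i ℕ.+ n)) (ℕ.+-identityʳ k))
    (trans (recurrence rec n) (lemma (F (k ℕ.+ n)) (F n)))
    where
    lemma : ∀ a b → + 2 * a + b ≡ b + + 2 * a
    lemma a b = solve (a ∷ b ∷ [])
  shift-period (suc e) {F} rec n = begin
    F (period k (suc e) ℕ.+ n)               ≡⟨ cong F (period-suc k e n) ⟩
    F (M ℕ.+ (M ℕ.+ n))                      ≡⟨ shift-period e rec (M ℕ.+ n) ⟩
    F (M ℕ.+ n) + + 2 * t * V F (M ℕ.+ n)    ≡⟨ cong₂ (λ a b → a + + 2 * t * b)
                                                   (shift-period e rec n)
                                                   (shift-period e (shiftQuotient-recurrent e rec) n) ⟩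
    F n + + 2 * t * V F n + + 2 * t * (V F n + + 2 * t * V (V F) n)
                                             ≡⟨ lemma (F n) (V F n) (V (V F) n) t ⟩
    F n + + 2 * (+ 2 * t) * (V F n + t * V (V F) n) ∎
    where
    open ≡-Reasoning
    M = period k e
    V = shiftQuotient k e
    t = (+ 2) ^ e
    lemma : ∀ a b c t → a + + 2 * t * b + + 2 * t * (b + + 2 * t * c)
                      ≡ a + + 2 * (+ 2 * t) * (b + t * c)
    lemma a b c t = solve (a ∷ b ∷ c ∷ t ∷ [])

  -- The binomial expansion of (1 + 2tV)^b, t = 2^e, to first order. All later terms carry (2t)^2,
  -- hence the factor 2 in front of `y`: modulo 2^(e+2) the shift is linear in b.
  shift-multiple : ∀ e b {F} → Recurrent k F → ∀ n → ∃[ y ]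
    F (b ℕ.* period k e ℕ.+ n) ≡ F n + (+ 2) ^ suc e * (+ b * shiftQuotient k e F n + + 2 * y)
  shift-multiple e zero    {F} rec n = + 0 , lemma (F n) ((+ 2) ^ suc e) (shiftQuotient k e F n)
    where
    lemma : ∀ a t v → a ≡ a + t * (+ 0 * v + + 2 * + 0)
    lemma a t v = solve (a ∷ t ∷ v ∷ [])
  shift-multiple e (suc b) {F} rec n with shift-multiple e b rec n
    | shift-multiple e b (shiftQuotient-recurrent e rec) n
  ... | y , eq | z , eq′ = _ , (begin
    F (M ℕ.+ b ℕ.* M ℕ.+ n)                ≡⟨ cong F (ℕ.+-assoc M (b ℕ.* M) n) ⟩
    F (M ℕ.+ (b ℕ.* M ℕ.+ n))              ≡⟨ shift-period e rec (b ℕ.* M ℕ.+ n) ⟩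
    F (b ℕ.* M ℕ.+ n) + + 2 * t * V F (b ℕ.* M ℕ.+ n)
                                           ≡⟨ cong₂ (λ a b → a + + 2 * t * b) eq eq′ ⟩
    F n + + 2 * t * (+ b * V F n + + 2 * y) + + 2 * t * (V F n + + 2 * t * w)
                                           ≡⟨ lemma (F n) (V F n) w y t (+ b) ⟩
    F n + + 2 * t * ((+ 1 + + b) * V F n + + 2 * (y + t * w)) ∎)
    where
    open ≡-Reasoning
    M = period k e
    V = shiftQuotient k e
    t = (+ 2) ^ e
    w = + b * V (V F) n + + 2 * z
    lemma : ∀ a v w y t b →
      a + + 2 * t * (b * v + + 2 * y) + + 2 * t * (v + + 2 * t * w)
      ≡ a + + 2 * t * ((+ 1 + b) * v + + 2 * (y + t * w))
    lemma a v w y t b = solve (a ∷ v ∷ w ∷ y ∷ t ∷ b ∷ [])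

  -- At level 1 the quotient is exactly x^k + x^(2k). Each later step adds a multiple of 2^e with e
  -- ≥ 1, so the parity never changes again.
  shiftQuotient-mod2 : ∀ e F n → ∃[ y ]
    shiftQuotient k (suc e) F n ≡ F (k ℕ.+ n) + F (k ℕ.+ (k ℕ.+ n)) + + 2 * y
  shiftQuotient-mod2 zero    F n = + 0 , lemma (F (k ℕ.+ n)) (F (k ℕ.+ (k ℕ.+ n)))
    where
    lemma : ∀ a b → a + + 1 * b ≡ a + b + + 2 * + 0
    lemma a b = solve (a ∷ b ∷ [])
  shiftQuotient-mod2 (suc e) F n with shiftQuotient-mod2 e F n
  ... | y , eq = _ , trans (cong (_+ _) eq)
    (lemma (F (k ℕ.+ n)) (F (k ℕ.+ (k ℕ.+ n))) y ((+ 2) ^ e)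
           (shiftQuotient k (suc e) (shiftQuotient k (suc e) F) n))
    where
    lemma : ∀ a b y t w → a + b + + 2 * y + + 2 * t * w ≡ a + b + + 2 * (y + t * w)
    lemma a b y t w = solve (a ∷ b ∷ y ∷ t ∷ w ∷ [])

-- The 2-adic descent

Even : ℤ → Set
Even z = + 2 ∣ z

2^n≢0 : ∀ n → NonZero ((+ 2) ^ n)
2^n≢0 zero    = _
2^n≢0 (suc n) = i*j≢0 (+ 2) ((+ 2) ^ n)
  where instance _ = 2^n≢0 n

pellℤ : ℕ → ℕ → ℤ
pellℤ k n = + pell k n

pell-suc : ∀ k n → pell k (suc k ℕ.+ n) ≡ 2 ℕ.* pell k (k ℕ.+ n) ℕ.+ pell k n
pell-suc k n = trans (pell-> (ℕ.m≤m+n (suc k) n))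
  (cong (λ i → 2 ℕ.* pell k (k ℕ.+ n) ℕ.+ pell k i) (ℕ.m+n∸m≡n k n))

pellℤ-recurrent : ∀ k → Recurrent k (pellℤ k)
pellℤ-recurrent k = recurrent λ n → trans (cong +_ (pell-suc k n))
  (trans (pos-+ (2 ℕ.* pell k (k ℕ.+ n)) _) (cong (_+ pellℤ k n) (pos-* 2 (pell k (k ℕ.+ n)))))

-- Modulo 2 the recurrence reads x^(k+1) = 1.
pellℤ-1+k+n-even : ∀ k n → Even (pellℤ k n) → Even (pellℤ k (suc k ℕ.+ n))
pellℤ-1+k+n-even k n even-n = subst Even (sym (recurrence (pellℤ-recurrent k) n))
  (∣m∣n⇒∣m+n (∣m⇒∣m*n (pellℤ k (k ℕ.+ n)) (divides (+ 1) refl)) even-n)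

pellℤ-<-even : ∀ k n → n < k → Even (pellℤ k n)
pellℤ-<-even k n n<k = subst (λ i → Even (+ i)) (sym (pell-< n<k)) (divides (+ 0) refl)

-- The values below k vanish, and reduction by k + 1 modulo 2 carries the indices from k + 1 to 2k
-- back below k.
pellℤ-even : ∀ k n → n ≤ k ℕ.+ k → n ≢ k → Even (pellℤ k n)
pellℤ-even k n n≤2k n≢k = case ℕ.<-cmp n k of λ where
  (tri< n<k _ _) → pellℤ-<-even k n n<k
  (tri≈ _ n≡k _) → contradiction n≡k n≢k
  (tri> _ _ k<n) → subst (λ i → Even (pellℤ k i)) (ℕ.m+[n∸m]≡n k<n)
    (pellℤ-1+k+n-even k (n ℕ.∸ suc k) (pellℤ-<-even k (n ℕ.∸ suc k) (ℕ.+-cancelˡ-< (suc k) _ _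
      (subst (_< suc k ℕ.+ k) (sym (ℕ.m+[n∸m]≡n k<n)) (s≤s n≤2k)))))

-- The two hypotheses serve all levels at once: level 0 is P(k+n) itself, and every higher level has
-- the parity of P(k+n) + P(2k+n).
shiftQuotient-even : ∀ k e n → Even (pellℤ k (k ℕ.+ n)) → Even (pellℤ k (k ℕ.+ (k ℕ.+ n))) →
  Even (shiftQuotient k e (pellℤ k) n)
shiftQuotient-even k zero    n even₁ even₂ = even₁
shiftQuotient-even k (suc e) n even₁ even₂ with shiftQuotient-mod2 e (pellℤ k) n
... | y , eq = subst Even (sym eq)
  (∣m∣n⇒∣m+n (∣m∣n⇒∣m+n even₁ even₂) (∣m⇒∣m*n y (divides (+ 1) refl)))

shiftQuotient-odd : ∀ k e n → Even (pellℤ k (k ℕ.+ n) - + 1) → Even (pellℤ k (k ℕ.+ (k ℕ.+ n))) →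
  Even (shiftQuotient k e (pellℤ k) n - + 1)
shiftQuotient-odd k zero    n odd₁ even₂ = odd₁
shiftQuotient-odd k (suc e) n odd₁ even₂ with shiftQuotient-mod2 e (pellℤ k) n
... | y , eq = subst Even (trans (lemma (pellℤ k (k ℕ.+ n)) (pellℤ k (k ℕ.+ (k ℕ.+ n))) y) (cong (_- + 1) (sym eq)))
  (∣m∣n⇒∣m+n (∣m∣n⇒∣m+n odd₁ even₂) (∣m⇒∣m*n y (divides (+ 1) refl)))
  where
  lemma : ∀ a b y → a - + 1 + b + + 2 * y ≡ a + b + + 2 * y - + 1
  lemma a b y = solve (a ∷ b ∷ y ∷ [])

-- In terms of the shift x and u = x^(k+1): x u^(p 2^e) - u^(q 2^e) = C u^(s 2^e) (x - 1).
Proportional : (k e p q s : ℕ) → ℤ → Set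
Proportional k e p q s C = ∀ n →
  pellℤ k (suc (p ℕ.* period k e ℕ.+ n)) - pellℤ k (q ℕ.* period k e ℕ.+ n)
  ≡ C * (pellℤ k (suc (s ℕ.* period k e ℕ.+ n)) - pellℤ k (s ℕ.* period k e ℕ.+ n))

-- Modulo 2^(e+2), with γ = (C - 1) / 2^(e+1).
proportional⇒parity : ∀ k₁ e p q s C → Proportional (suc k₁) e p q s C → let k = suc k₁ in
  ∃[ γ ] ∀ n → Even ((+ p - + s) * shiftQuotient k e (pellℤ k) (suc n)
                     + (+ s - + q) * shiftQuotient k e (pellℤ k) n
                     - γ * (pellℤ k (suc n) - pellℤ k n))
proportional⇒parity k₁ e p q s C prop = γ , λ n → divides (w n) (parity-eq n)
  where
  k = suc k₁
  t = (+ 2) ^ e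
  v = shiftQuotient k e (pellℤ k)

  multiple : ∀ b n → ∃[ y ] pellℤ k (b ℕ.* period k e ℕ.+ n) ≡ pellℤ k n + + 2 * t * (+ b * v n + + 2 * y)
  multiple b = shift-multiple e b (pellℤ-recurrent k)

  y : ℕ → ℕ → ℤ
  y b n = proj₁ (multiple b n)

  -- The quotient (u^(b 2^e) - 1) / 2^(e+1) applied to P, with u = x^(k+1).
  X : ℕ → ℕ → ℤ
  X b n = + b * v n + + 2 * y b n

  suc-multiple : ∀ b n → pellℤ k (suc (b ℕ.* period k e ℕ.+ n)) ≡ pellℤ k (suc n) + + 2 * t * X b (suc n)
  suc-multiple b n = trans (cong (pellℤ k) (sym (ℕ.+-suc (b ℕ.* period k e) n))) (proj₂ (multiple b (suc n)))

  expanded : ∀ n → pellℤ k (suc n) + + 2 * t * X p (suc n) - (pellℤ k n + + 2 * t * X q n)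
    ≡ C * (pellℤ k (suc n) + + 2 * t * X s (suc n) - (pellℤ k n + + 2 * t * X s n))
  expanded n = begin
    pellℤ k (suc n) + + 2 * t * X p (suc n) - (pellℤ k n + + 2 * t * X q n)
      ≡⟨ cong₂ _-_ (suc-multiple p n) (proj₂ (multiple q n)) ⟨
    pellℤ k (suc (p ℕ.* period k e ℕ.+ n)) - pellℤ k (q ℕ.* period k e ℕ.+ n)
      ≡⟨ prop n ⟩
    C * (pellℤ k (suc (s ℕ.* period k e ℕ.+ n)) - pellℤ k (s ℕ.* period k e ℕ.+ n))
      ≡⟨ cong (C *_) (cong₂ _-_ (suc-multiple s n) (proj₂ (multiple s n))) ⟩
    C * (pellℤ k (suc n) + + 2 * t * X s (suc n) - (pellℤ k n + + 2 * t * X s n)) ∎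
    where open ≡-Reasoning

  -- Read off from the relation at n = k - 1: there P(k) - P(k-1) = 1, so the equation can be solved
  -- for C - 1 and shows the factor 2t.
  γ : ℤ
  γ = X p k - X q k₁ - C * (X s k - X s k₁)

  C≡1+2tγ : C ≡ + 1 + + 2 * t * γ
  C≡1+2tγ = begin
    C                                         ≡⟨ lemma₁ C t (X s k) (X s k₁) ⟩
    C * (+ 1 + + 2 * t * X s k - (+ 0 + + 2 * t * X s k₁)) - C * (+ 2 * t * (X s k - X s k₁))
      ≡⟨ cong (_- C * (+ 2 * t * (X s k - X s k₁))) at-k₁ ⟨
    + 1 + + 2 * t * X p k - (+ 0 + + 2 * t * X q k₁) - C * (+ 2 * t * (X s k - X s k₁))
      ≡⟨ lemma₂ C t (X p k) (X q k₁) (X s k - X s k₁) ⟩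
    + 1 + + 2 * t * γ ∎
    where
    open ≡-Reasoning
    at-k₁ : + 1 + + 2 * t * X p k - (+ 0 + + 2 * t * X q k₁)
          ≡ C * (+ 1 + + 2 * t * X s k - (+ 0 + + 2 * t * X s k₁))
    at-k₁ = subst₂ (λ a b → + a + + 2 * t * X p k - (+ b + + 2 * t * X q k₁)
                         ≡ C * (+ a + + 2 * t * X s k - (+ b + + 2 * t * X s k₁)))
              (pell-≡ k) (pell-< {k} ℕ.≤-refl) (expanded k₁)
    lemma₁ : ∀ C t a b → C ≡ C * (+ 1 + + 2 * t * a - (+ 0 + + 2 * t * b)) - C * (+ 2 * t * (a - b))
    lemma₁ C t a b = solve (C ∷ t ∷ a ∷ b ∷ [])
    lemma₂ : ∀ C t a b d → + 1 + + 2 * t * a - (+ 0 + + 2 * t * b) - C * (+ 2 * t * d)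
                       ≡ + 1 + + 2 * t * (a - b - C * d)
    lemma₂ C t a b d = solve (C ∷ t ∷ a ∷ b ∷ d ∷ [])

  cancelled : ∀ n → X p (suc n) - X q n
    ≡ γ * (pellℤ k (suc n) - pellℤ k n) + (+ 1 + + 2 * t * γ) * (X s (suc n) - X s n)
  cancelled n = *-cancelˡ-≡ (+ 2 * t) _ _ {{2^n≢0 (suc e)}} (begin
    + 2 * t * (X p (suc n) - X q n)
      ≡⟨ lemma₁ a′ a t (X p (suc n)) (X q n) ⟩
    a′ + + 2 * t * X p (suc n) - (a + + 2 * t * X q n) - (a′ - a)
      ≡⟨ cong (_- (a′ - a)) (expanded n) ⟩
    C * (a′ + + 2 * t * X s (suc n) - (a + + 2 * t * X s n)) - (a′ - a)
      ≡⟨ cong (λ c → c * (a′ + + 2 * t * X s (suc n) - (a + + 2 * t * X s n)) - (a′ - a)) C≡1+2tγ ⟩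
    (+ 1 + + 2 * t * γ) * (a′ + + 2 * t * X s (suc n) - (a + + 2 * t * X s n)) - (a′ - a)
      ≡⟨ lemma₂ a′ a t (X s (suc n)) (X s n) γ ⟩
    + 2 * t * (γ * (a′ - a) + (+ 1 + + 2 * t * γ) * (X s (suc n) - X s n)) ∎)
    where
    open ≡-Reasoning
    a′ = pellℤ k (suc n)
    a  = pellℤ k n
    lemma₁ : ∀ a′ a t x y → + 2 * t * (x - y) ≡ a′ + + 2 * t * x - (a + + 2 * t * y) - (a′ - a)
    lemma₁ a′ a t x y = solve (a′ ∷ a ∷ t ∷ x ∷ y ∷ [])
    lemma₂ : ∀ a′ a t x y γ → (+ 1 + + 2 * t * γ) * (a′ + + 2 * t * x - (a + + 2 * t * y)) - (a′ - a)
      ≡ + 2 * t * (γ * (a′ - a) + (+ 1 + + 2 * t * γ) * (x - y))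
    lemma₂ a′ a t x y γ = solve (a′ ∷ a ∷ t ∷ x ∷ y ∷ γ ∷ [])

  -- Half of what is dropped modulo 2: the second-order terms 2y of the expansions and the product
  -- of 2tγ with the difference of the `X s`.
  w : ℕ → ℤ
  w n = t * γ * (X s (suc n) - X s n) - y p (suc n) + y q n + y s (suc n) - y s n

  parity-eq : ∀ n → (+ p - + s) * v (suc n) + (+ s - + q) * v n - γ * (pellℤ k (suc n) - pellℤ k n)
    ≡ w n * + 2
  parity-eq n = begin
    (+ p - + s) * v (suc n) + (+ s - + q) * v n - γ * D
      ≡⟨ lemma₁ (+ p) (+ q) (+ s) (v (suc n)) (v n) (y p (suc n)) (y q n) (y s (suc n)) (y s n) (γ * D) ⟩
    (X p (suc n) - X q n) - (X s (suc n) - X s n) - γ * D - + 2 * (y p (suc n) - y q n - y s (suc n) + y s n)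
      ≡⟨ cong (λ z → z - (X s (suc n) - X s n) - γ * D - + 2 * (y p (suc n) - y q n - y s (suc n) + y s n))
              (cancelled n) ⟩
    (γ * D + (+ 1 + + 2 * t * γ) * (X s (suc n) - X s n)) - (X s (suc n) - X s n) - γ * D
      - + 2 * (y p (suc n) - y q n - y s (suc n) + y s n)
      ≡⟨ lemma₂ (γ * D) t γ (X s (suc n) - X s n) (y p (suc n)) (y q n) (y s (suc n)) (y s n) ⟩
    w n * + 2 ∎
    where
    open ≡-Reasoning
    D = pellℤ k (suc n) - pellℤ k n
    lemma₁ : ∀ p q s v′ v y₁ y₂ y₃ y₄ g → (p - s) * v′ + (s - q) * v - g
      ≡ (p * v′ + + 2 * y₁ - (q * v + + 2 * y₂)) - (s * v′ + + 2 * y₃ - (s * v + + 2 * y₄)) - g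
        - + 2 * (y₁ - y₂ - y₃ + y₄)
    lemma₁ p q s v′ v y₁ y₂ y₃ y₄ g = solve (p ∷ q ∷ s ∷ v′ ∷ v ∷ y₁ ∷ y₂ ∷ y₃ ∷ y₄ ∷ g ∷ [])
    lemma₂ : ∀ g t γ x y₁ y₂ y₃ y₄ → (g + (+ 1 + + 2 * t * γ) * x) - x - g - + 2 * (y₁ - y₂ - y₃ + y₄)
      ≡ (t * γ * x - y₁ + y₂ + y₃ - y₄) * + 2
    lemma₂ g t γ x y₁ y₂ y₃ y₄ = solve (g ∷ t ∷ γ ∷ x ∷ y₁ ∷ y₂ ∷ y₃ ∷ y₄ ∷ [])

cancel-odd : ∀ {a b} → Even (b - + 1) → Even (a * b) → Even a
cancel-odd {a} {b} odd-b even-ab = subst Even (lemma a b) (∣m∣n⇒∣m-n even-ab (∣n⇒∣m*n a odd-b))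
  where
  lemma : ∀ a b → a * b - a * (b - + 1) ≡ a
  lemma a b = solve (a ∷ b ∷ [])

-- The congruence of `proportional⇒parity` is evaluated at three places. At n = k - 1 both values of
-- v are even and P(k) - P(k-1) = 1, so γ is even. At n = k, v(k+1) is odd and v(k) even, which
-- isolates p - s. At n = 0, v(0) is odd, which then isolates s - q.
proportional⇒same-parity : ∀ {k} → 3 ≤ k → ∀ e p q s C → Proportional k e p q s C →
  Even (+ p - + s) × Even (+ s - + q)
proportional⇒same-parity {suc k₁} 3≤k e p q s C prop = even-p-s , even-s-q
  where
  k = suc k₁
  P = pellℤ k
  v = shiftQuotient k e P
  γ = proj₁ (proportional⇒parity k₁ e p q s C prop)
  even-at = proj₂ (proportional⇒parity k₁ e p q s C prop)

  k₁≢0 : k₁ ≢ 0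
  k₁≢0 refl = contradiction 3≤k λ { (s≤s ()) }

  k₁≢1 : k₁ ≢ 1
  k₁≢1 refl = contradiction 3≤k λ { (s≤s (s≤s ())) }

  k₁≤k : k₁ ≤ k
  k₁≤k = ℕ.n≤1+n k₁

  k+n≢k : ∀ {n} → n ≢ 0 → k ℕ.+ n ≢ k
  k+n≢k n≢0 eq = n≢0 (ℕ.+-cancelˡ-≡ k _ _ (trans eq (sym (ℕ.+-identityʳ k))))

  even-2k : Even (P (k ℕ.+ k))
  even-2k = pellℤ-even k (k ℕ.+ k) ℕ.≤-refl (k+n≢k λ ())

  odd-k : Even (P k - + 1)
  odd-k = subst (λ i → Even (+ i - + 1)) (sym (pell-≡ k)) (divides (+ 0) refl)

  even-v-k₁ : Even (v k₁)
  even-v-k₁ = shiftQuotient-even k e k₁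
    (pellℤ-even k (k ℕ.+ k₁) (ℕ.+-monoʳ-≤ k k₁≤k) (k+n≢k k₁≢0))
    -- As 2k + k₁ = (k + 1) + 2k₁, the parity is that of P(2k₁), and 2k₁ = k would mean k = 2.
    (subst (λ i → Even (P i)) (cong suc (sym (ℕ.+-suc k₁ (k₁ ℕ.+ k₁))))
      (pellℤ-1+k+n-even k (k₁ ℕ.+ k₁)
        (pellℤ-even k (k₁ ℕ.+ k₁) (ℕ.+-mono-≤ k₁≤k k₁≤k)
          λ eq → k₁≢1 (ℕ.+-cancelʳ-≡ k₁ k₁ 1 eq))))

  even-v-k : Even (v k)
  even-v-k = shiftQuotient-even k e k even-2k
    (subst (λ i → Even (P i)) (cong suc (sym (ℕ.+-suc k₁ (k₁ ℕ.+ k))))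
      (pellℤ-1+k+n-even k (k₁ ℕ.+ k)
        (pellℤ-even k (k₁ ℕ.+ k) (ℕ.+-monoˡ-≤ k k₁≤k) λ eq → k₁≢0 (ℕ.+-cancelʳ-≡ k k₁ 0 eq))))

  odd-v-1+k : Even (v (suc k) - + 1)
  odd-v-1+k = shiftQuotient-odd k e (suc k)
    (subst (λ z → Even (z - + 1)) (sym P[k+[1+k]])
      (subst Even (lemma (P (k ℕ.+ k)) (P k)) (∣m∣n⇒∣m+n (∣m⇒∣m*n (P (k ℕ.+ k)) (divides (+ 1) refl)) odd-k)))
    (subst (λ i → Even (P i))
      (trans (sym (ℕ.+-suc k (k ℕ.+ k))) (cong (k ℕ.+_) (sym (ℕ.+-suc k k))))
      (pellℤ-1+k+n-even k (k ℕ.+ k) even-2k))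
    where
    P[k+[1+k]] : P (k ℕ.+ suc k) ≡ + 2 * P (k ℕ.+ k) + P k
    P[k+[1+k]] = trans (cong P (ℕ.+-suc k k)) (recurrence (pellℤ-recurrent k) k)
    lemma : ∀ a b → + 2 * a + (b - + 1) ≡ + 2 * a + b - + 1
    lemma a b = solve (a ∷ b ∷ [])

  odd-v-0 : Even (v 0 - + 1)
  odd-v-0 = shiftQuotient-odd k e 0
    (subst (λ i → Even (P i - + 1)) (sym (ℕ.+-identityʳ k)) odd-k)
    (subst (λ i → Even (P (k ℕ.+ i))) (sym (ℕ.+-identityʳ k)) even-2k)

  even-γ : Even γ
  even-γ = cancel-odd {b = P k - P k₁}
    (subst₂ (λ a b → Even (+ a - + b - + 1)) (sym (pell-≡ k)) (sym (pell-< {k} ℕ.≤-refl)) (divides (+ 0) refl))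
    (subst Even (lemma ((+ p - + s) * v k) ((+ s - + q) * v k₁) (γ * (P k - P k₁)))
      (∣m∣n⇒∣m-n (∣m∣n⇒∣m+n (∣n⇒∣m*n (+ p - + s) even-v-k) (∣n⇒∣m*n (+ s - + q) even-v-k₁)) (even-at k₁)))
    where
    lemma : ∀ a b c → a + b - (a + b - c) ≡ c
    lemma a b c = solve (a ∷ b ∷ c ∷ [])

  even-p-s : Even (+ p - + s)
  even-p-s = cancel-odd {b = v (suc k)} odd-v-1+k
    (subst Even (lemma ((+ p - + s) * v (suc k)) ((+ s - + q) * v k) (γ * (P (suc k) - P k)))
      (∣m∣n⇒∣m+n (∣m∣n⇒∣m-n (even-at k) (∣n⇒∣m*n (+ s - + q) even-v-k)) (∣m⇒∣m*n (P (suc k) - P k) even-γ)))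
    where
    lemma : ∀ a b c → a + b - c - b + c ≡ a
    lemma a b c = solve (a ∷ b ∷ c ∷ [])

  even-s-q : Even (+ s - + q)
  even-s-q = cancel-odd {b = v 0} odd-v-0
    (subst Even (lemma ((+ p - + s) * v 1) ((+ s - + q) * v 0) (γ * (P 1 - P 0)))
      (∣m∣n⇒∣m+n (∣m∣n⇒∣m-n (even-at 0) (∣m⇒∣m*n (v 1) even-p-s)) (∣m⇒∣m*n (P 1 - P 0) even-γ)))
    where
    lemma : ∀ a b c → a + b - c - a + c ≡ b
    lemma a b c = solve (a ∷ b ∷ c ∷ [])

even⇒double : ∀ {n} → Even (+ n) → ∃[ h ] n ≡ 2 ℕ.* h
even⇒double even-n with ∣⇒∣ᵤ even-n
... | ℕ.divides h eq = h , trans eq (ℕ.*-comm h 2)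

even⊎even-suc : ∀ n → Even (+ n) ⊎ Even (+ suc n)
even⊎even-suc zero    = inj₁ (divides (+ 0) refl)
even⊎even-suc (suc n) with even⊎even-suc n
... | inj₁ even-n  = inj₂ (∣m∣n⇒∣m+n {m = + 2} (divides (+ 1) refl) even-n)
... | inj₂ even-1+n = inj₁ even-1+n

-- Replacing n by n plus r periods raises p, q and s by r, and two periods of level e make one of
-- level e + 1.
proportional-halve : ∀ {k e C} r p q s {p′ q′ s′} → r ℕ.+ p ≡ 2 ℕ.* p′ → r ℕ.+ q ≡ 2 ℕ.* q′ → r ℕ.+ s ≡ 2 ℕ.* s′ →
  Proportional k e p q s C → Proportional k (suc e) p′ q′ s′ C
proportional-halve {k} {e} {C} r p q s {p′} {q′} {s′} eq-p eq-q eq-s prop n = begin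
  P (suc (p′ ℕ.* M′ ℕ.+ n)) - P (q′ ℕ.* M′ ℕ.+ n)
    ≡⟨ cong₂ (λ i j → P (suc i) - P j) (shifted p p′ eq-p) (shifted q q′ eq-q) ⟩
  P (suc (p ℕ.* M ℕ.+ (r ℕ.* M ℕ.+ n))) - P (q ℕ.* M ℕ.+ (r ℕ.* M ℕ.+ n))
    ≡⟨ prop (r ℕ.* M ℕ.+ n) ⟩
  C * (P (suc (s ℕ.* M ℕ.+ (r ℕ.* M ℕ.+ n))) - P (s ℕ.* M ℕ.+ (r ℕ.* M ℕ.+ n)))
    ≡⟨ cong (λ i → C * (P (suc i) - P i)) (shifted s s′ eq-s) ⟨
  C * (P (suc (s′ ℕ.* M′ ℕ.+ n)) - P (s′ ℕ.* M′ ℕ.+ n)) ∎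
  where
  open ≡-Reasoning
  P  = pellℤ k
  M  = period k e
  M′ = period k (suc e)
  shifted : ∀ x x′ → r ℕ.+ x ≡ 2 ℕ.* x′ → x′ ℕ.* M′ ℕ.+ n ≡ x ℕ.* M ℕ.+ (r ℕ.* M ℕ.+ n)
  shifted x x′ eq = begin
    x′ ℕ.* (2 ℕ.* 2 ℕ.^ e ℕ.* suc k) ℕ.+ n ≡⟨ cong (λ i → x′ ℕ.* i ℕ.+ n) (ℕ.*-assoc 2 (2 ℕ.^ e) (suc k)) ⟩
    x′ ℕ.* (2 ℕ.* M) ℕ.+ n                 ≡⟨ cong (ℕ._+ n) (ℕ.*-assoc x′ 2 M) ⟨
    x′ ℕ.* 2 ℕ.* M ℕ.+ n                   ≡⟨ cong (λ i → i ℕ.* M ℕ.+ n) (trans (ℕ.*-comm x′ 2) (trans (sym eq) (ℕ.+-comm r x))) ⟩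
    (x ℕ.+ r) ℕ.* M ℕ.+ n                  ≡⟨ cong (ℕ._+ n) (ℕ.*-distribʳ-+ M x r) ⟩
    x ℕ.* M ℕ.+ r ℕ.* M ℕ.+ n              ≡⟨ ℕ.+-assoc (x ℕ.* M) (r ℕ.* M) n ⟩
    x ℕ.* M ℕ.+ (r ℕ.* M ℕ.+ n)            ∎

-- r is chosen to make r + s even; p and q have the same parity as s.
halves : ∀ {p q s} → Even (+ p - + s) → Even (+ s - + q) → ∃[ r ] ∃[ p′ ] ∃[ q′ ] ∃[ s′ ]
  r ℕ.+ p ≡ 2 ℕ.* p′ × r ℕ.+ q ≡ 2 ℕ.* q′ × r ℕ.+ s ≡ 2 ℕ.* s′
halves {p} {q} {s} even-p-s even-s-q = [ halves-with 0 , halves-with 1 ]′ (even⊎even-suc s)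
  where
  even-r+p : ∀ r s p → Even (r + s) → Even (p - s) → Even (r + p)
  even-r+p r s p even-r+s even = subst Even lemma (∣m∣n⇒∣m+n even-r+s even)
    where
    lemma : r + s + (p - s) ≡ r + p
    lemma = solve (r ∷ s ∷ p ∷ [])
  even-r+q : ∀ r s q → Even (r + s) → Even (s - q) → Even (r + q)
  even-r+q r s q even-r+s even = subst Even lemma (∣m∣n⇒∣m-n even-r+s even)
    where
    lemma : r + s - (s - q) ≡ r + q
    lemma = solve (r ∷ s ∷ q ∷ [])
  halves-with : ∀ r → Even (+ (r ℕ.+ s)) → ∃[ r ] ∃[ p′ ] ∃[ q′ ] ∃[ s′ ]
    r ℕ.+ p ≡ 2 ℕ.* p′ × r ℕ.+ q ≡ 2 ℕ.* q′ × r ℕ.+ s ≡ 2 ℕ.* s′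
  halves-with r even-r+s
    with even⇒double {r ℕ.+ p} (even-r+p (+ r) (+ s) (+ p) even-r+s even-p-s)
       | even⇒double {r ℕ.+ q} (even-r+q (+ r) (+ s) (+ q) even-r+s even-s-q)
       | even⇒double even-r+s
  ... | p′ , eq-p | q′ , eq-q | s′ , eq-s = r , p′ , q′ , s′ , eq-p , eq-q , eq-s

-- Raising p, q and s by r ∈ {0, 1} and halving them halves ∣ p - q ∣.
proportional⇒≡ : ∀ {k} → 3 ≤ k → ∀ e p q s C → Proportional k e p q s C → p ≡ q
proportional⇒≡ {k} 3≤k e p q s C prop = descend e p q s prop (<-wellFounded ℕ.∣ p - q ∣)
  where
  descend : ∀ e p q s → Proportional k e p q s C → Acc _<_ ℕ.∣ p - q ∣ → p ≡ q
  descend e p q s prop (acc smaller) = case p ℕ.≟ q of λ where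
      (yes p≡q) → p≡q
      (no p≢q)  → contradiction (step (halves even-p-s even-s-q) p≢q) p≢q
    where
    even-p-s = proj₁ (proportional⇒same-parity 3≤k e p q s C prop)
    even-s-q = proj₂ (proportional⇒same-parity 3≤k e p q s C prop)
    step : ∃[ r ] ∃[ p′ ] ∃[ q′ ] ∃[ s′ ] r ℕ.+ p ≡ 2 ℕ.* p′ × r ℕ.+ q ≡ 2 ℕ.* q′ × r ℕ.+ s ≡ 2 ℕ.* s′ →
      p ≢ q → p ≡ q
    step (r , p′ , q′ , s′ , eq-p , eq-q , eq-s) p≢q = ℕ.∣m-n∣≡0⇒m≡n
      (trans d≡2d′ (cong (2 ℕ.*_) (ℕ.m≡n⇒∣m-n∣≡0 p′≡q′)))
      where
      d≡2d′ : ℕ.∣ p - q ∣ ≡ 2 ℕ.* ℕ.∣ p′ - q′ ∣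
      d≡2d′ = begin
        ℕ.∣ p - q ∣                   ≡⟨ ℕ.∣m+n-m+o∣≡∣n-o∣ r p q ⟨
        ℕ.∣ r ℕ.+ p - r ℕ.+ q ∣       ≡⟨ cong₂ ℕ.∣_-_∣ eq-p eq-q ⟩
        ℕ.∣ 2 ℕ.* p′ - 2 ℕ.* q′ ∣     ≡⟨ ℕ.*-distribˡ-∣-∣ 2 p′ q′ ⟨
        2 ℕ.* ℕ.∣ p′ - q′ ∣           ∎
        where open ≡-Reasoning
      d′<d : ℕ.∣ p′ - q′ ∣ < ℕ.∣ p - q ∣
      d′<d = subst (ℕ.∣ p′ - q′ ∣ <_) (sym (trans d≡2d′ (cong (ℕ.∣ p′ - q′ ∣ ℕ.+_) (ℕ.+-identityʳ _))))
        (ℕ.m<m+n _ (ℕ.n≢0⇒n>0 λ d′≡0 → p≢q (ℕ.∣m-n∣≡0⇒m≡n (trans d≡2d′ (cong (2 ℕ.*_) d′≡0)))))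
      p′≡q′ : p′ ≡ q′
      p′≡q′ = descend (suc e) p′ q′ s′
        (proportional-halve {k} {e} {C} r p q s {p′} {q′} {s′} eq-p eq-q eq-s prop) (smaller d′<d)

-- Residues modulo k+1

periodic-mod2 : ∀ k b n → Even (pellℤ k (b ℕ.* period k 0 ℕ.+ n) - pellℤ k n)
periodic-mod2 k b n with shift-multiple 0 b (pellℤ-recurrent k) n
... | y , eq = divides (+ b * pellℤ k (k ℕ.+ n) + + 2 * y)
  (trans (cong (_- pellℤ k n) eq) (lemma (pellℤ k n) (+ b * pellℤ k (k ℕ.+ n) + + 2 * y)))
  where
  lemma : ∀ a z → a + + 2 * + 1 * z - a ≡ z * + 2
  lemma a z = solve (a ∷ z ∷ [])

-- The relation x^b - x^a = C (x - 1) modulo 2.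
Proportional-mod2 : (k a b : ℕ) → ℤ → Set
Proportional-mod2 k a b C = ∀ n →
  Even (pellℤ k (b ℕ.+ n) - pellℤ k (a ℕ.+ n) - C * (pellℤ k (suc n) - pellℤ k n))

-- Lets `proportional-mod2⇒≤1`, which bounds only a, bound b as well.
proportional-mod2-sym : ∀ k a b C → Proportional-mod2 k a b C → Proportional-mod2 k b a (- C)
proportional-mod2-sym k a b C prop n =
  subst Even (lemma (pellℤ k (b ℕ.+ n)) (pellℤ k (a ℕ.+ n)) C (pellℤ k (suc n) - pellℤ k n)) (∣m⇒∣-m (prop n))
  where
  lemma : ∀ x y C d → - (x - y - C * d) ≡ y - x - - C * d
  lemma x y C d = solve (x ∷ y ∷ C ∷ d ∷ [])

¬even-1 : ¬ Even (+ 1)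
¬even-1 even-1 with even⇒double {1} even-1
... | suc h , eq = ℕ.1+n≢0 (sym (trans (ℕ.suc-injective eq) (ℕ.+-suc h (h ℕ.+ 0))))

-- At n = k - a the term x^a contributes the odd number P(k) and, if a ≥ 2, all other terms are even.
proportional-mod2⇒≤1 : ∀ k a b C → a ≤ k → b ≤ k → a ≢ b → Proportional-mod2 k a b C → a ≤ 1
proportional-mod2⇒≤1 k a b C a≤k b≤k a≢b prop = ℕ.≮⇒≥ λ 1<a →
  let
    n = k ℕ.∸ a
    a+n≡k : a ℕ.+ n ≡ k
    a+n≡k = ℕ.m+[n∸m]≡n a≤k
    1+n<k : suc n < k
    1+n<k = subst (2 ℕ.+ n ≤_) a+n≡k (ℕ.+-monoˡ-≤ n 1<a)
    even-rhs = ∣n⇒∣m*n C (∣m∣n⇒∣m-n (pellℤ-<-even k (suc n) 1+n<k) (pellℤ-<-even k n (ℕ.<-trans (ℕ.n<1+n n) 1+n<k)))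
    even-b+n = pellℤ-even k (b ℕ.+ n) (ℕ.+-mono-≤ b≤k (ℕ.m∸n≤m k a))
      λ b+n≡k → a≢b (ℕ.+-cancelʳ-≡ n a b (trans a+n≡k (sym b+n≡k)))
    even-k : Even (pellℤ k (a ℕ.+ n))
    even-k = subst Even (lemma (pellℤ k (b ℕ.+ n)) (pellℤ k (a ℕ.+ n)) (C * (pellℤ k (suc n) - pellℤ k n)))
      (∣m∣n⇒∣m-n even-b+n (∣m∣n⇒∣m+n (prop n) even-rhs))
  in ¬even-1 (subst (λ i → Even (+ i)) (trans (cong (pell k) a+n≡k) (pell-≡ k)) even-k)
  where
  lemma : ∀ x y z → x - (x - y - z + z) ≡ y
  lemma x y z = solve (x ∷ y ∷ z ∷ [])

divide : ∀ k x → ∃[ r ] ∃[ q ] (r ≤ k × x ≡ r ℕ.+ q ℕ.* period k 0)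
divide k x = x % suc k , x / suc k , ℕ.s≤s⁻¹ (m%n<n x (suc k)) ,
  trans (m≡m%n+[m/n]*n x (suc k))
    (cong (λ K → x % suc k ℕ.+ (x / suc k) ℕ.* K) (sym (ℕ.*-identityˡ (suc k))))

-- Let a and b be the residues of A and m + A modulo k+1, with quotients q and p. They differ
-- because k+1 is even and m odd, and modulo 2 both are at most 1. The descent gives p = q in either
-- case: then a = 0, b = 1 yields m = 1, while a = 1, b = 0 yields A = m + A + 1.
no-proportional-multiple : ∀ {k m} → 3 ≤ k → Even (+ suc k) → ¬ Even (+ m) → 1 < m → ∀ A s C →
  ¬ (∀ n → pellℤ k (m ℕ.+ A ℕ.+ n) - pellℤ k (A ℕ.+ n)
         ≡ C * (pellℤ k (suc (s ℕ.* period k 0 ℕ.+ n)) - pellℤ k (s ℕ.* period k 0 ℕ.+ n)))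
no-proportional-multiple {k} {m} 3≤k even-1+k odd-m 1<m A s C prop
  with divide k A | divide k (m ℕ.+ A)
... | a , q , a≤k , A≡ | b , p , b≤k , m+A≡ =
  finish a b (proportional-mod2⇒≤1 k a b C a≤k b≤k a≢b mod2)
    (proportional-mod2⇒≤1 k b a (- C) b≤k a≤k (λ b≡a → a≢b (sym b≡a)) (proportional-mod2-sym k a b C mod2)) a≢b A≡ m+A≡
  where
  K = period k 0
  P = pellℤ k

  even-K : Even (+ K)
  even-K = subst (λ i → Even (+ i)) (sym (ℕ.*-identityˡ (suc k))) even-1+k

  a≢b : a ≢ b
  a≢b refl = odd-m (subst Even (sym m≡) (∣n⇒∣m*n (+ p - + q) even-K))
    where
    open ≡-Reasoning
    lemma₁ : ∀ m A → m ≡ m + A - A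
    lemma₁ m A = solve (m ∷ A ∷ [])
    lemma₂ : ∀ a p q K → a + p * K - (a + q * K) ≡ (p - q) * K
    lemma₂ a p q K = solve (a ∷ p ∷ q ∷ K ∷ [])
    +divide : ∀ {x} q → x ≡ a ℕ.+ q ℕ.* K → + x ≡ + a + + q * + K
    +divide q refl = cong (λ z → + a + z) (pos-* q K)
    m≡ : + m ≡ (+ p - + q) * + K
    m≡ = begin
      + m                                     ≡⟨ lemma₁ (+ m) (+ A) ⟩
      + m + + A - + A                         ≡⟨ cong₂ _-_ (+divide p m+A≡) (+divide q A≡) ⟩
      + a + + p * + K - (+ a + + q * + K)     ≡⟨ lemma₂ (+ a) (+ p) (+ q) (+ K) ⟩
      (+ p - + q) * + K                       ∎

  reindex : ∀ {x} r q → x ≡ r ℕ.+ q ℕ.* K → ∀ n → x ℕ.+ n ≡ q ℕ.* K ℕ.+ (r ℕ.+ n)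
  reindex r q refl n = trans (cong (ℕ._+ n) (ℕ.+-comm r (q ℕ.* K))) (ℕ.+-assoc (q ℕ.* K) r n)

  mod2 : Proportional-mod2 k a b C
  -- Every term is moved to its residue at the cost of an even amount; the exact relation `prop`
  -- then cancels the original terms.
  mod2 n = subst Even eq (∣m∣n⇒∣m-n
    (∣n⇒∣m*n C (∣m∣n⇒∣m-n
      (subst (λ i → Even (P i - P (suc n))) (ℕ.+-suc (s ℕ.* K) n) (periodic-mod2 k s (suc n)))
      (periodic-mod2 k s n)))
    (∣m∣n⇒∣m-n (periodic-mod2 k p (b ℕ.+ n)) (periodic-mod2 k q (a ℕ.+ n))))
    where
    open ≡-Reasoning
    lemma₁ : ∀ C d′ d e′ e u v x y → C * (d′ - d - (e′ - e)) - (u - x - (v - y))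
      ≡ C * (d′ - e′) - (u - v) + (x - y - C * (d - e))
    lemma₁ C d′ d e′ e u v x y = solve (C ∷ d′ ∷ d ∷ e′ ∷ e ∷ u ∷ v ∷ x ∷ y ∷ [])
    lemma₂ : ∀ z w → z - z + w ≡ w
    lemma₂ z w = solve (z ∷ w ∷ [])
    D = P (suc (s ℕ.* K ℕ.+ n)) - P (s ℕ.* K ℕ.+ n)
    u = P (p ℕ.* K ℕ.+ (b ℕ.+ n))
    v = P (q ℕ.* K ℕ.+ (a ℕ.+ n))
    goal = P (b ℕ.+ n) - P (a ℕ.+ n) - C * (P (suc n) - P n)
    u-v≡ : u - v ≡ C * D
    u-v≡ = trans (sym (cong₂ (λ i j → P i - P j) (reindex b p m+A≡ n) (reindex a q A≡ n))) (prop n)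
    eq : C * (P (suc (s ℕ.* K ℕ.+ n)) - P (suc n) - (P (s ℕ.* K ℕ.+ n) - P n)) - (u - P (b ℕ.+ n) - (v - P (a ℕ.+ n))) ≡ goal
    eq = begin
      C * (P (suc (s ℕ.* K ℕ.+ n)) - P (suc n) - (P (s ℕ.* K ℕ.+ n) - P n)) - (u - P (b ℕ.+ n) - (v - P (a ℕ.+ n)))
        ≡⟨ lemma₁ C (P (suc (s ℕ.* K ℕ.+ n))) (P (suc n)) (P (s ℕ.* K ℕ.+ n)) (P n) u v (P (b ℕ.+ n)) (P (a ℕ.+ n)) ⟩
      C * D - (u - v) + goal ≡⟨ cong (λ z → C * D - z + goal) u-v≡ ⟩
      C * D - C * D + goal   ≡⟨ lemma₂ (C * D) goal ⟩
      goal                   ∎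

  finish : ∀ a b → a ≤ 1 → b ≤ 1 → a ≢ b → A ≡ a ℕ.+ q ℕ.* K → m ℕ.+ A ≡ b ℕ.+ p ℕ.* K → ⊥
  finish zero zero _ _ a≢b _ _ = a≢b refl
  finish (suc zero) (suc zero) _ _ a≢b _ _ = a≢b refl
  finish (suc (suc _)) _ (s≤s ()) _ _ _ _
  finish _ (suc (suc _)) _ (s≤s ()) _ _ _
  finish zero (suc zero) _ _ _ A≡ m+A≡ = ℕ.<⇒≢ 1<m (ℕ.+-cancelʳ-≡ A 1 m
    (trans (cong suc (trans A≡ (cong (ℕ._* K) (sym p≡q)))) (sym m+A≡)))
    where
    p≡q : p ≡ q
    p≡q = proportional⇒≡ 3≤k 0 p q s C λ n →
      trans (sym (cong₂ (λ i j → P (i ℕ.+ n) - P (j ℕ.+ n)) m+A≡ A≡)) (prop n)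
  finish (suc zero) zero _ _ _ A≡ m+A≡ = ℕ.<⇒≢ (s≤s (ℕ.m≤n+m A m))
    (trans A≡ (cong suc (trans (cong (ℕ._* K) q≡p) (sym m+A≡))))
    where
    lemma₁ : ∀ x y → y - x ≡ - (x - y)
    lemma₁ x y = solve (x ∷ y ∷ [])
    lemma₂ : ∀ C d → - (C * d) ≡ - C * d
    lemma₂ C d = solve (C ∷ d ∷ [])
    q≡p : q ≡ p
    q≡p = proportional⇒≡ 3≤k 0 q p s (- C) λ n → begin
      P (suc (q ℕ.* K ℕ.+ n)) - P (p ℕ.* K ℕ.+ n)
        ≡⟨ cong₂ (λ i j → P (i ℕ.+ n) - P (j ℕ.+ n)) A≡ m+A≡ ⟨
      P (A ℕ.+ n) - P (m ℕ.+ A ℕ.+ n)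
        ≡⟨ lemma₁ (P (m ℕ.+ A ℕ.+ n)) (P (A ℕ.+ n)) ⟩
      - (P (m ℕ.+ A ℕ.+ n) - P (A ℕ.+ n))
        ≡⟨ cong -_ (prop n) ⟩
      - (C * (P (suc (s ℕ.* K ℕ.+ n)) - P (s ℕ.* K ℕ.+ n)))
        ≡⟨ lemma₂ C (P (suc (s ℕ.* K ℕ.+ n)) - P (s ℕ.* K ℕ.+ n)) ⟩
      - C * (P (suc (s ℕ.* K ℕ.+ n)) - P (s ℕ.* K ℕ.+ n)) ∎
      where open ≡-Reasoning

-- Replacing n by n + kB turns the shift B into (k+1) B, a whole number of periods.
no-proportional : ∀ {k m} → 3 ≤ k → Even (+ suc k) → ¬ Even (+ m) → 1 < m → ∀ A B C →
  ¬ (∀ n → pellℤ k (m ℕ.+ A ℕ.+ n) - pellℤ k (A ℕ.+ n) ≡ C * (pellℤ k (suc (B ℕ.+ n)) - pellℤ k (B ℕ.+ n)))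
no-proportional {k} {m} 3≤k even-1+k odd-m 1<m A B C prop =
  no-proportional-multiple {k} {m} 3≤k even-1+k odd-m 1<m (A ℕ.+ k ℕ.* B) B C λ n → begin
    P (m ℕ.+ (A ℕ.+ k ℕ.* B) ℕ.+ n) - P (A ℕ.+ k ℕ.* B ℕ.+ n)
      ≡⟨ cong₂ (λ i j → P i - P j)
           (trans (cong (ℕ._+ n) (sym (ℕ.+-assoc m A (k ℕ.* B)))) (ℕ.+-assoc (m ℕ.+ A) (k ℕ.* B) n))
           (ℕ.+-assoc A (k ℕ.* B) n) ⟩
    P (m ℕ.+ A ℕ.+ (k ℕ.* B ℕ.+ n)) - P (A ℕ.+ (k ℕ.* B ℕ.+ n))
      ≡⟨ prop (k ℕ.* B ℕ.+ n) ⟩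
    C * (P (suc (B ℕ.+ (k ℕ.* B ℕ.+ n))) - P (B ℕ.+ (k ℕ.* B ℕ.+ n)))
      ≡⟨ cong (λ i → C * (P (suc i) - P i)) (index n) ⟩
    C * (P (suc (B ℕ.* period k 0 ℕ.+ n)) - P (B ℕ.* period k 0 ℕ.+ n)) ∎
  where
  open ≡-Reasoning
  P = pellℤ k
  index : ∀ n → B ℕ.+ (k ℕ.* B ℕ.+ n) ≡ B ℕ.* period k 0 ℕ.+ n
  index n = trans (sym (ℕ.+-assoc B (k ℕ.* B) n))
    (cong (ℕ._+ n) (trans (ℕ.*-comm (suc k) B) (cong (B ℕ.*_) (sym (ℕ.*-identityˡ (suc k))))))

-- Sums of consecutive terms

-- The starting point moves with the recursion, so bounds between consecutive terms pass to the sums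
-- by induction on the length.
window : (ℕ → ℕ) → ℕ → ℕ → ℕ
window f zero    n = 0
window f (suc m) n = f n ℕ.+ window f m (suc n)

-- Set against the defining equation, which peels off the first term, this gives S(n+1) - S(n) =
-- f(n+m) - f(n).
window-snoc : ∀ f m n → window f (suc m) n ≡ window f m n ℕ.+ f (m ℕ.+ n)
window-snoc f zero    n = ℕ.+-comm (f n) 0
window-snoc f (suc m) n = begin
  f n ℕ.+ window f (suc m) (suc n)                        ≡⟨ cong (f n ℕ.+_) (window-snoc f m (suc n)) ⟩
  f n ℕ.+ (window f m (suc n) ℕ.+ f (m ℕ.+ suc n))        ≡⟨ ℕ.+-assoc (f n) _ _ ⟨
  f n ℕ.+ window f m (suc n) ℕ.+ f (m ℕ.+ suc n)          ≡⟨ cong (λ i → window f (suc m) n ℕ.+ f i) (ℕ.+-suc m n) ⟩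
  f n ℕ.+ window f m (suc n) ℕ.+ f (suc m ℕ.+ n)          ∎
  where open ≡-Reasoning

-- `g` is kept apart from `f` because `applyUpTo` passes to a shifted function at each step.
sum-applyUpTo : ∀ f g m n → (∀ i → g i ≡ f (n ℕ.+ i)) → sum (applyUpTo g m) ≡ window f m n
sum-applyUpTo f g zero    n g≗f = refl
sum-applyUpTo f g (suc m) n g≗f = cong₂ ℕ._+_ (trans (g≗f 0) (cong f (ℕ.+-identityʳ n)))
  (sum-applyUpTo f (λ i → g (suc i)) m (suc n) λ i → trans (g≗f (suc i)) (cong f (ℕ.+-suc n i)))

pellSum≡window : ∀ k N n → pellSum k N n ≡ window (pell k) (suc (2 ℕ.* N)) n
pellSum≡window k N n = trans (cong sum (map-upTo (λ i → pell k (n ℕ.+ i)) (suc (2 ℕ.* N))))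
  (sum-applyUpTo (pell k) _ (suc (2 ℕ.* N)) n λ _ → refl)

-- Growth of the sums and the index j(n)

pell-suc-≥ : ∀ {k n} → k ≤ n → pell k (suc n) ≡ 2 ℕ.* pell k n ℕ.+ pell k (n ℕ.∸ k)
pell-suc-≥ k≤n = pell-> (s≤s k≤n)

2*pell≤pell-suc : ∀ k n → 2 ℕ.* pell k n ≤ pell k (suc n)
2*pell≤pell-suc k n = [ below , above ]′ (ℕ.<-≤-connex n k)
  where
  below : n < k → 2 ℕ.* pell k n ≤ pell k (suc n)
  below n<k = subst (λ z → 2 ℕ.* z ≤ pell k (suc n)) (sym (pell-< n<k)) z≤n
  above : k ≤ n → 2 ℕ.* pell k n ≤ pell k (suc n)
  above k≤n = subst (2 ℕ.* pell k n ≤_) (sym (pell-suc-≥ k≤n)) (ℕ.m≤m+n _ _)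

pell-mono-+ : ∀ k n d → pell k n ≤ pell k (d ℕ.+ n)
pell-mono-+ k n zero    = ℕ.≤-refl
pell-mono-+ k n (suc d) = ℕ.≤-trans (pell-mono-+ k n d)
  (ℕ.≤-trans (ℕ.m≤m+n _ _) (2*pell≤pell-suc k (d ℕ.+ n)))

pell-mono-≤ : ∀ k {m n} → m ≤ n → pell k m ≤ pell k n
pell-mono-≤ k {m} {n} m≤n = subst (λ i → pell k m ≤ pell k i) (ℕ.m∸n+n≡m m≤n) (pell-mono-+ k m (n ℕ.∸ m))

pell-suc≤3*pell : ∀ {k n} → k ≤ n → pell k (suc n) ≤ 3 ℕ.* pell k n
pell-suc≤3*pell {k} {n} k≤n = begin
  pell k (suc n)                            ≡⟨ pell-suc-≥ k≤n ⟩
  2 ℕ.* pell k n ℕ.+ pell k (n ℕ.∸ k)       ≤⟨ ℕ.+-monoʳ-≤ (2 ℕ.* pell k n) (pell-mono-≤ k (ℕ.m∸n≤m n k)) ⟩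
  2 ℕ.* pell k n ℕ.+ pell k n               ≡⟨ ℕ.+-comm (2 ℕ.* pell k n) (pell k n) ⟩
  3 ℕ.* pell k n                            ∎
  where open ℕ.≤-Reasoning

2*window≤window-suc : ∀ k m n → 2 ℕ.* window (pell k) m n ≤ window (pell k) m (suc n)
2*window≤window-suc k zero    n = z≤n
2*window≤window-suc k (suc m) n = ℕ.≤-trans (ℕ.≤-reflexive (ℕ.*-distribˡ-+ 2 (pell k n) _))
  (ℕ.+-mono-≤ (2*pell≤pell-suc k n) (2*window≤window-suc k m (suc n)))

window-suc≤3*window : ∀ k m {n} → k ≤ n → window (pell k) m (suc n) ≤ 3 ℕ.* window (pell k) m n
window-suc≤3*window k zero    k≤n = z≤n
window-suc≤3*window k (suc m) {n} k≤n = ℕ.≤-trans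
  (ℕ.+-mono-≤ (pell-suc≤3*pell k≤n) (window-suc≤3*window k m (ℕ.m≤n⇒m≤1+n k≤n)))
  (ℕ.≤-reflexive (sym (ℕ.*-distribˡ-+ 3 (pell k n) _)))

window-positive : ∀ k m {n} → k ≤ n → 0 < window (pell k) (suc m) n
window-positive k m {n} k≤n = ℕ.≤-trans (subst (_≤ pell k n) (pell-≡ k) (pell-mono-≤ k k≤n)) (ℕ.m≤m+n _ _)

-- Monotonicity of P excludes the alternatives: j′ ≤ j gives S(n+1) ≤ S(n) < 2S(n) ≤ S(n+1), and j′
-- ≥ j + 2 gives S(n+1) ≥ 4S(n) > 3S(n) ≥ S(n+1).
index-step : ∀ {k m n c j j′} → k ≤ n →
  window (pell k) (suc m) n ≡ c ℕ.* pell k j → window (pell k) (suc m) (suc n) ≡ c ℕ.* pell k j′ → j′ ≡ suc j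
index-step {k} {m} {n} {c} {j} {j′} k≤n eq eq′ = ℕ.≤-antisym (ℕ.≮⇒≥ not-above) (ℕ.≰⇒> not-below)
  where
  P = pell k
  S = window P (suc m)
  0<S : 0 < S n
  0<S = window-positive k m k≤n
  open ℕ.≤-Reasoning
  not-below : ¬ (j′ ≤ j)
  not-below j′≤j = ℕ.<-irrefl refl (begin-strict
    S n           <⟨ ℕ.m<m+n (S n) (subst (0 <_) (sym (ℕ.+-identityʳ (S n))) 0<S) ⟩
    2 ℕ.* S n     ≤⟨ 2*window≤window-suc k (suc m) n ⟩
    S (suc n)     ≡⟨ eq′ ⟩
    c ℕ.* P j′    ≤⟨ ℕ.*-monoʳ-≤ c (pell-mono-≤ k j′≤j) ⟩
    c ℕ.* P j     ≡⟨ eq ⟨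
    S n           ∎)
  not-above : ¬ (suc j < j′)
  not-above 1+j<j′ = ℕ.<-irrefl refl (begin-strict
    S (suc n)                 ≤⟨ window-suc≤3*window k (suc m) k≤n ⟩
    3 ℕ.* S n                 <⟨ ℕ.m<n+m (3 ℕ.* S n) 0<S ⟩
    4 ℕ.* S n                 ≡⟨ cong (4 ℕ.*_) eq ⟩
    4 ℕ.* (c ℕ.* P j)         ≡⟨ trans (sym (ℕ.*-assoc 4 c (P j))) (trans (cong (ℕ._* P j) (ℕ.*-comm 4 c)) (ℕ.*-assoc c 4 (P j))) ⟩
    c ℕ.* (4 ℕ.* P j)         ≡⟨ cong (c ℕ.*_) (ℕ.*-assoc 2 2 (P j)) ⟩
    c ℕ.* (2 ℕ.* (2 ℕ.* P j)) ≤⟨ ℕ.*-monoʳ-≤ c (ℕ.*-monoʳ-≤ 2 (2*pell≤pell-suc k j)) ⟩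
    c ℕ.* (2 ℕ.* P (suc j))   ≤⟨ ℕ.*-monoʳ-≤ c (2*pell≤pell-suc k (suc j)) ⟩
    c ℕ.* P (2 ℕ.+ j)         ≤⟨ ℕ.*-monoʳ-≤ c (pell-mono-≤ k 1+j<j′) ⟩
    c ℕ.* P j′                ≡⟨ eq′ ⟨
    S (suc n)                 ∎)

-- Iterating `index-step` from n = k replaces the arbitrary choice of indices by a single shift.
index-shift : ∀ {k m c} (j : ℕ → ℕ) → (∀ n → window (pell k) (suc m) n ≡ c ℕ.* pell k (j n)) →
  ∀ n → window (pell k) (suc m) (k ℕ.+ n) ≡ c ℕ.* pell k (j k ℕ.+ n)
index-shift {k} {m} {c} j S≡ n = trans (S≡ (k ℕ.+ n)) (cong (λ i → c ℕ.* pell k i) (index n))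
  where
  index : ∀ n → j (k ℕ.+ n) ≡ j k ℕ.+ n
  index zero    = trans (cong j (ℕ.+-identityʳ k)) (sym (ℕ.+-identityʳ (j k)))
  index (suc n) = begin
    j (k ℕ.+ suc n)     ≡⟨ cong j (ℕ.+-suc k n) ⟩
    j (suc (k ℕ.+ n))   ≡⟨ index-step {k} {m} {k ℕ.+ n} {c} (ℕ.m≤m+n k n) (S≡ (k ℕ.+ n)) (S≡ (suc (k ℕ.+ n))) ⟩
    suc (j (k ℕ.+ n))   ≡⟨ cong suc (index n) ⟩
    suc (j k ℕ.+ n)     ≡⟨ ℕ.+-suc (j k) n ⟨
    j k ℕ.+ suc n       ∎
    where open ≡-Reasoning

-- A negative C would make the product zero or negative, according to whether x is zero.
positive-multiplier : ∀ {C x y} → 0 < y → + y ≡ C * + x → ∃[ c ] C ≡ + c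
positive-multiplier {+ c}                0<y eq = c , refl
positive-multiplier { -[1+ c ]} {zero}  {suc y} 0<y eq =
  contradiction (trans (cong ∣_∣ eq) (trans (abs-* -[1+ c ] (+ 0)) (ℕ.*-zeroʳ (suc c)))) λ ()
positive-multiplier { -[1+ c ]} {suc x} 0<y ()

-- The case k = 1 and the norm form of ℤ[√2]

pellNorm : ℕ → ℤ
pellNorm n = pellℤ 1 (suc n) * pellℤ 1 (suc n) - + 2 * pellℤ 1 n * pellℤ 1 (suc n) - pellℤ 1 n * pellℤ 1 n

-- With x = P(n) and y = P(n+1) the form is (y - x)^2 - 2x^2, the norm of (y - x) + x√2 = (1 +
-- √2)^n; each step multiplies it by the norm -1 of 1 + √2.
pellNorm≡ : ∀ n → pellNorm n ≡ (- + 1) ^ n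
pellNorm≡ zero    = refl
pellNorm≡ (suc n) = begin
  r′ * r′ - + 2 * r * r′ - r * r
    ≡⟨ cong (λ z → z * z - + 2 * r * z - r * r) (recurrence (pellℤ-recurrent 1) n) ⟩
  (+ 2 * r + p) * (+ 2 * r + p) - + 2 * r * (+ 2 * r + p) - r * r
    ≡⟨ lemma r p ⟩
  - + 1 * (r * r - + 2 * p * r - p * p)
    ≡⟨ cong (- + 1 *_) (pellNorm≡ n) ⟩
  - + 1 * (- + 1) ^ n ∎
  where
  open ≡-Reasoning
  p  = pellℤ 1 n
  r  = pellℤ 1 (suc n)
  r′ = pellℤ 1 (suc (suc n))
  lemma : ∀ r p → (+ 2 * r + p) * (+ 2 * r + p) - + 2 * r * (+ 2 * r + p) - r * r
    ≡ - + 1 * (r * r - + 2 * p * r - p * p)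
  lemma r p = solve (r ∷ p ∷ [])

[-1]^n≡±1 : ∀ n → (- + 1) ^ n ≡ + 1 ⊎ (- + 1) ^ n ≡ - + 1
[-1]^n≡±1 zero    = inj₁ refl
[-1]^n≡±1 (suc n) = [ (λ eq → inj₂ (cong (- + 1 *_) eq)) , (λ eq → inj₁ (cong (- + 1 *_) eq)) ]′ ([-1]^n≡±1 n)

-- Telescoping: P(m+2) - P(m+1) exceeds P(m+1) - P(m) by 2P(m), and the first difference is 1.
pell₁-window : ∀ m → pellℤ 1 (suc m) - pellℤ 1 m ≡ + 2 * + window (pell 1) m 0 + + 1
pell₁-window zero    = refl
pell₁-window (suc m) = begin
  pellℤ 1 (2 ℕ.+ m) - r           ≡⟨ cong (_- r) (recurrence (pellℤ-recurrent 1) m) ⟩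
  + 2 * r + p - r                 ≡⟨ lemma₁ r p ⟩
  (r - p) + + 2 * p               ≡⟨ cong (_+ + 2 * p) (pell₁-window m) ⟩
  + 2 * W + + 1 + + 2 * p         ≡⟨ lemma₂ W p ⟩
  + 2 * (W + p) + + 1             ≡⟨ cong (λ z → + 2 * + z + + 1) W′≡ ⟨
  + 2 * + window (pell 1) (suc m) 0 + + 1 ∎
  where
  open ≡-Reasoning
  p = pellℤ 1 m
  r = pellℤ 1 (suc m)
  W = + window (pell 1) m 0
  W′≡ : window (pell 1) (suc m) 0 ≡ window (pell 1) m 0 ℕ.+ pell 1 m
  W′≡ = trans (window-snoc (pell 1) m 0) (cong (λ i → window (pell 1) m 0 ℕ.+ pell 1 i) (ℕ.+-identityʳ m))
  lemma₁ : ∀ r p → + 2 * r + p - r ≡ (r - p) + + 2 * p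
  lemma₁ r p = solve (r ∷ p ∷ [])
  lemma₂ : ∀ W p → + 2 * W + + 1 + + 2 * p ≡ + 2 * (W + p) + + 1
  lemma₂ W p = solve (W ∷ p ∷ [])

-- Put s = S(0).  The norm form y² - 2xy - x² takes the value -(2s + 1) at
-- (S(1), S(2)) = c (P(j), P(j+1)) and ±1 at (P(j), P(j+1)), while S(2) - 2 S(1) = s;
-- so c divides both 2s + 1 and s, whence c = 1 and 2s + 1 = ±1.
no-shift-multiple₁ : ∀ N c j → 0 < N →
  ¬ (∀ n → window (pell 1) (suc (2 ℕ.* N)) (suc n) ≡ c ℕ.* pell 1 (j ℕ.+ n))
no-shift-multiple₁ N c j 0<N S≡ = [ plus , minus ]′ ([-1]^n≡±1 j)
  where
  open ≡-Reasoning
  m  = suc (2 ℕ.* N)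
  S  = window (pell 1) m
  s  = + S 0
  p  = pellℤ 1 m
  r  = pellℤ 1 (suc m)
  x  = pellℤ 1 j
  y  = pellℤ 1 (suc j)
  δ  = pellNorm j

  0<S₀ : 0 < S 0
  0<S₀ = positive N 0<N
    where
    positive : ∀ N → 0 < N → 0 < window (pell 1) (suc (2 ℕ.* N)) 0
    -- For N > 0 the sum computes past P(0) = 0 to the summand P(1) = 1.
    positive (suc N) _ = s≤s z≤n

  -- The number m of summands is odd, so (-1)^m = -1.
  norm-m : r * r - + 2 * p * r - p * p ≡ - + 1
  norm-m = trans (pellNorm≡ m) (cong (- + 1 *_) (trans (sym (^-*-assoc (- + 1) 2 N)) (^-zeroˡ N)))

  r≡ : r ≡ + 2 * s + + 1 + p
  r≡ = trans (lemma r p) (cong (_+ p) (pell₁-window m))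
    where
    lemma : ∀ r p → r ≡ r - p + p
    lemma r p = solve (r ∷ p ∷ [])

  window-shift : ∀ n → + S (suc n) ≡ + S n + pellℤ 1 (m ℕ.+ n) - pellℤ 1 n
  window-shift n = trans (lemma (+ S (suc n)) (pellℤ 1 n))
    (cong (λ z → + z - pellℤ 1 n) (window-snoc (pell 1) m n))
    where
    lemma : ∀ a b → a ≡ b + a - b
    lemma a b = solve (a ∷ b ∷ [])

  S₁≡ : + c * x ≡ s + p
  S₁≡ = begin
    + c * x                         ≡⟨ pos-* c (pell 1 j) ⟨
    + (c ℕ.* pell 1 j)              ≡⟨ cong (λ i → + (c ℕ.* pell 1 i)) (ℕ.+-identityʳ j) ⟨
    + (c ℕ.* pell 1 (j ℕ.+ 0))      ≡⟨ cong +_ (S≡ 0) ⟨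
    + S 1                           ≡⟨ window-shift 0 ⟩
    s + pellℤ 1 (m ℕ.+ 0) - + 0     ≡⟨ cong (λ i → s + pellℤ 1 i - + 0) (ℕ.+-identityʳ m) ⟩
    s + p - + 0                     ≡⟨ lemma s p ⟩
    s + p                           ∎
    where
    lemma : ∀ s p → s + p - + 0 ≡ s + p
    lemma s p = solve (s ∷ p ∷ [])

  S₂≡ : + c * y ≡ + 3 * s + + 2 * p
  S₂≡ = begin
    + c * y                             ≡⟨ pos-* c (pell 1 (suc j)) ⟨
    + (c ℕ.* pell 1 (suc j))            ≡⟨ cong (λ i → + (c ℕ.* pell 1 i)) (ℕ.+-comm j 1) ⟨
    + (c ℕ.* pell 1 (j ℕ.+ 1))          ≡⟨ cong +_ (S≡ 1) ⟨
    + S 2                               ≡⟨ window-shift 1 ⟩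
    + S 1 + pellℤ 1 (m ℕ.+ 1) - + 1     ≡⟨ cong₂ (λ a i → a + pellℤ 1 i - + 1) S[1]≡ (ℕ.+-comm m 1) ⟩
    s + p + r - + 1                     ≡⟨ cong (λ z → s + p + z - + 1) r≡ ⟩
    s + p + (+ 2 * s + + 1 + p) - + 1   ≡⟨ lemma s p ⟩
    + 3 * s + + 2 * p                   ∎
    where
    S[1]≡ : + S 1 ≡ s + p
    S[1]≡ = trans (cong +_ (trans (S≡ 0) (cong (λ i → c ℕ.* pell 1 i) (ℕ.+-identityʳ j))))
                  (trans (pos-* c (pell 1 j)) S₁≡)
    lemma : ∀ s p → s + p + (+ 2 * s + + 1 + p) - + 1 ≡ + 3 * s + + 2 * p
    lemma s p = solve (s ∷ p ∷ [])

  c²δ≡ : + c * + c * δ ≡ - (+ 2 * s + + 1)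
  -- Doubled because twice the form at (S(1), S(2)) is 4s^2 - 2p^2 = (r - p)^2 - 2p^2 - (4s + 1)
  -- with r - p = 2s + 1, and `norm-m` evaluates (r - p)^2 - 2p^2.
  c²δ≡ = *-cancelˡ-≡ (+ 2) _ _ (begin
    + 2 * (+ c * + c * δ)
      ≡⟨ lemma₁ (+ c) x y ⟩
    + 2 * (+ c * y * (+ c * y) - + 2 * (+ c * x) * (+ c * y) - + c * x * (+ c * x))
      ≡⟨ cong₂ (λ a b → + 2 * (b * b - + 2 * a * b - a * a)) S₁≡ S₂≡ ⟩
    + 2 * (b * b - + 2 * a * b - a * a)
      ≡⟨ lemma₂ s p ⟩
    r₀ * r₀ - + 2 * p * r₀ - p * p - (+ 4 * s + + 1)
      ≡⟨ cong (λ z → z * z - + 2 * p * z - p * p - (+ 4 * s + + 1)) r≡ ⟨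
    r * r - + 2 * p * r - p * p - (+ 4 * s + + 1)
      ≡⟨ cong (_- (+ 4 * s + + 1)) norm-m ⟩
    - + 1 - (+ 4 * s + + 1)
      ≡⟨ lemma₃ s ⟩
    + 2 * - (+ 2 * s + + 1) ∎)
    where
    a  = s + p
    b  = + 3 * s + + 2 * p
    r₀ = + 2 * s + + 1 + p
    lemma₁ : ∀ c x y → + 2 * (c * c * (y * y - + 2 * x * y - x * x))
      ≡ + 2 * (c * y * (c * y) - + 2 * (c * x) * (c * y) - c * x * (c * x))
    lemma₁ c x y = solve (c ∷ x ∷ y ∷ [])
    lemma₂ : ∀ s p → + 2 * ((+ 3 * s + + 2 * p) * (+ 3 * s + + 2 * p) - + 2 * (s + p) * (+ 3 * s + + 2 * p) - (s + p) * (s + p))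
      ≡ (+ 2 * s + + 1 + p) * (+ 2 * s + + 1 + p) - + 2 * p * (+ 2 * s + + 1 + p) - p * p - (+ 4 * s + + 1)
    lemma₂ s p = solve (s ∷ p ∷ [])
    lemma₃ : ∀ s → - + 1 - (+ 4 * s + + 1) ≡ + 2 * - (+ 2 * s + + 1)
    lemma₃ s = solve (s ∷ [])

  c-unit : + c * (+ c * δ + + 2 * (y - + 2 * x)) ≡ - + 1
  c-unit = begin
    + c * (+ c * δ + + 2 * (y - + 2 * x))
      ≡⟨ lemma₁ (+ c) δ x y ⟩
    + c * + c * δ + + 2 * (+ c * y - + 2 * (+ c * x))
      ≡⟨ cong₂ (λ u v → u + + 2 * v) c²δ≡ (cong₂ (λ a b → b - + 2 * a) S₁≡ S₂≡) ⟩
    - (+ 2 * s + + 1) + + 2 * (+ 3 * s + + 2 * p - + 2 * (s + p))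
      ≡⟨ lemma₂ s p ⟩
    - + 1 ∎
    where
    lemma₁ : ∀ c δ x y → c * (c * δ + + 2 * (y - + 2 * x)) ≡ c * c * δ + + 2 * (c * y - + 2 * (c * x))
    lemma₁ c δ x y = solve (c ∷ δ ∷ x ∷ y ∷ [])
    lemma₂ : ∀ s p → - (+ 2 * s + + 1) + + 2 * (+ 3 * s + + 2 * p - + 2 * (s + p)) ≡ - + 1
    lemma₂ s p = solve (s ∷ p ∷ [])

  c≡1 : c ≡ 1
  c≡1 = ℕ.m*n≡1⇒m≡1 c _ (trans (sym (abs-* (+ c) (+ c * δ + + 2 * (y - + 2 * x)))) (cong ∣_∣ c-unit))

  δ+2s+1≡0 : δ + (+ 2 * s + + 1) ≡ + 0
  δ+2s+1≡0 = begin
    δ + (+ 2 * s + + 1)                      ≡⟨ cong (_+ (+ 2 * s + + 1)) (lemma₁ δ) ⟩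
    + 1 * + 1 * δ + (+ 2 * s + + 1)          ≡⟨ cong (λ i → + i * + i * δ + (+ 2 * s + + 1)) c≡1 ⟨
    + c * + c * δ + (+ 2 * s + + 1)          ≡⟨ cong (_+ (+ 2 * s + + 1)) c²δ≡ ⟩
    - (+ 2 * s + + 1) + (+ 2 * s + + 1)      ≡⟨ lemma₂ (+ 2 * s + + 1) ⟩
    + 0                                      ∎
    where
    lemma₁ : ∀ δ → δ ≡ + 1 * + 1 * δ
    lemma₁ δ = solve (δ ∷ [])
    lemma₂ : ∀ z → - z + z ≡ + 0
    lemma₂ z = solve (z ∷ [])

  s+≡0 : ∀ {z} → z ≡ δ → z + (+ 2 * s + + 1) ≡ + 0
  s+≡0 refl = δ+2s+1≡0

  plus : (- + 1) ^ j ≡ + 1 → ⊥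
  plus eq = absurd (*-cancelˡ-≡ (+ 2) _ (+ 0) (trans (lemma s) (s+≡0 (sym (trans (pellNorm≡ j) eq)))))
    where
    lemma : ∀ s → + 2 * (+ 1 + s) ≡ + 1 + (+ 2 * s + + 1)
    lemma s = solve (s ∷ [])
    absurd : + 1 + s ≡ + 0 → ⊥
    absurd ()

  minus : (- + 1) ^ j ≡ - + 1 → ⊥
  minus eq = ℕ.<⇒≢ 0<S₀ (sym (cong ∣_∣ (*-cancelˡ-≡ (+ 2) s (+ 0) (trans (lemma s) (s+≡0 (sym (trans (pellNorm≡ j) eq)))))))
    where
    lemma : ∀ s → + 2 * s ≡ - + 1 + (+ 2 * s + + 1)
    lemma s = solve (s ∷ [])

-- Odd k ≥ 3 and the conclusion

parity≡1⇒even-suc : ∀ {k} → parity k ≡ 1ℙ → Even (+ suc k)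
parity≡1⇒even-suc {k} odd-k = [ (λ even-k → contradiction odd-k (parity≢1 (even⇒double even-k))) , (λ even → even) ]′
  (even⊎even-suc k)
  where
  parity≢1 : ∃[ h ] k ≡ 2 ℕ.* h → parity k ≢ 1ℙ
  parity≢1 (h , refl) odd = case trans (sym odd) (*-homo-* 2 h) of λ ()

¬even-1+2n : ∀ n → ¬ Even (+ suc (2 ℕ.* n))
¬even-1+2n n even with even⇒double even
... | h , eq = ℕ.even≢odd h n (sym eq)

-- Subtracting the hypothesis at n from that at n + 1 leaves P(m+k+n) - P(k+n) on the left, the
-- relation excluded by `no-proportional`.
no-shift-multiple : ∀ {k m} → 3 ≤ k → Even (+ suc k) → ¬ Even (+ m) → 1 < m → ∀ c j →
  ¬ (∀ n → window (pell k) m (k ℕ.+ n) ≡ c ℕ.* pell k (j ℕ.+ n))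
no-shift-multiple {k} {m} 3≤k even-1+k odd-m 1<m c j S≡ =
  no-proportional {k} {m} 3≤k even-1+k odd-m 1<m k j (+ c) λ n → begin
    P (m ℕ.+ k ℕ.+ n) - P (k ℕ.+ n)
      ≡⟨ cong (λ i → P i - P (k ℕ.+ n)) (ℕ.+-assoc m k n) ⟩
    P (m ℕ.+ (k ℕ.+ n)) - P (k ℕ.+ n)
      ≡⟨ lemma₁ (+ S (k ℕ.+ n)) (P (m ℕ.+ (k ℕ.+ n))) (P (k ℕ.+ n)) ⟩
    + S (k ℕ.+ n) + P (m ℕ.+ (k ℕ.+ n)) - P (k ℕ.+ n) - + S (k ℕ.+ n)
      ≡⟨ cong (λ z → + z - P (k ℕ.+ n) - + S (k ℕ.+ n)) (window-snoc (pell k) m (k ℕ.+ n)) ⟨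
    P (k ℕ.+ n) + + S (suc (k ℕ.+ n)) - P (k ℕ.+ n) - + S (k ℕ.+ n)
      ≡⟨ lemma₂ (P (k ℕ.+ n)) (+ S (suc (k ℕ.+ n))) (+ S (k ℕ.+ n)) ⟩
    + S (suc (k ℕ.+ n)) - + S (k ℕ.+ n)
      ≡⟨ cong₂ _-_ (S-suc n) (+S≡ n) ⟩
    + c * P (suc (j ℕ.+ n)) - + c * P (j ℕ.+ n)
      ≡⟨ lemma₃ (+ c) (P (suc (j ℕ.+ n))) (P (j ℕ.+ n)) ⟩
    + c * (P (suc (j ℕ.+ n)) - P (j ℕ.+ n)) ∎
  where
  open ≡-Reasoning
  P = pellℤ k
  S = window (pell k) m
  +S≡ : ∀ n → + S (k ℕ.+ n) ≡ + c * P (j ℕ.+ n)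
  +S≡ n = trans (cong +_ (S≡ n)) (pos-* c (pell k (j ℕ.+ n)))
  S-suc : ∀ n → + S (suc (k ℕ.+ n)) ≡ + c * P (suc (j ℕ.+ n))
  S-suc n = trans (cong (λ i → + S i) (sym (ℕ.+-suc k n)))
    (trans (+S≡ (suc n)) (cong (λ i → + c * P i) (ℕ.+-suc j n)))
  lemma₁ : ∀ S x y → x - y ≡ S + x - y - S
  lemma₁ S x y = solve (S ∷ x ∷ y ∷ [])
  lemma₂ : ∀ y S′ S → y + S′ - y - S ≡ S′ - S
  lemma₂ y S′ S = solve (y ∷ S′ ∷ S ∷ [])
  lemma₃ : ∀ c x y → c * x - c * y ≡ c * (x - y)
  lemma₃ c x y = solve (c ∷ x ∷ y ∷ [])

theorem7p5 : ∀ (k N : ℕ) → 1 ≤ k → parity k ≡ 1ℙ → 0 < N →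
    ¬ (Σ[ C ∈ ℤ ] (∀ (n : ℕ) → Σ[ j ∈ ℕ ] (+ pellSum k N n ≡ C * + pell k j)))
theorem7p5 k N 1≤k odd-k 0<N (C , multiple) =
  -- The sum starting at n = k contains P(k) = 1 and is positive, so C is a natural number.
  case positive-multiplier {C} {pell k (j k)} (window-positive k (2 ℕ.* N) {k} ℕ.≤-refl) (+S≡ k) of λ where
    (c , C≡) → no-multiple k odd-k c (j k) (index-shift {k} {2 ℕ.* N} {c} j λ n →
      +-injective (trans (+S≡ n) (trans (cong (_* + pell k (j n)) C≡) (sym (pos-* c (pell k (j n)))))))
  where
  m = suc (2 ℕ.* N)
  j : ℕ → ℕ
  j n = proj₁ (multiple n)
  +S≡ : ∀ n → + window (pell k) m n ≡ C * + pell k (j n)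
  +S≡ n = trans (cong +_ (sym (pellSum≡window k N n))) (proj₂ (multiple n))
  no-multiple : ∀ k → parity k ≡ 1ℙ → ∀ c j → ¬ (∀ n → window (pell k) m (k ℕ.+ n) ≡ c ℕ.* pell k (j ℕ.+ n))
  -- There are no clauses for 0 and 2, where `parity k ≡ 1ℙ` is empty.
  no-multiple 1 odd-k c j = no-shift-multiple₁ N c j 0<N
  no-multiple (suc (suc (suc k))) odd-k =
    no-shift-multiple (s≤s (s≤s (s≤s z≤n))) (parity≡1⇒even-suc odd-k) (¬even-1+2n N) (s≤s (ℕ.m≤n⇒m≤n+o _ 0<N))
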